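{- Let $\mathit{td}(n)$ be a function of $n$ and let $\mathcal{G}$ be the family of (connected) graphs of tree-depth at most $\mathit{td}(n)$. Let $\delta_{\mathcal{G}}(n)=\max\{\delta(\mathcal{A}(G)) : G\in\mathcal{G},\ |V(G)|=n\}$. Then $\delta_{\mathcal{G}}(n) = \Theta(\mathit{td}(n)\cdot n)$.
   Context: All graphs are finite, simple and connected. For a graph $G=(V,E)$, a search tree on $G$ is a rooted tree with vertex set $V$ defined recursively: its root is some vertex $r\in V$, and $r$ is joined to the roots of search trees on each connected component of $G-r$. The tubes of a search tree are the vertex sets of its subtrees. Two search trees on $G$ are related by a rotation if their sets of tubes have symmetric difference of size exactly two. The graph associahedron $\mathcal{A}(G)$ is a polytope whose skeleton is isomorphic to the graph on search trees of $G$ with adjacency given by rotations; $\delta(\mathcal{A}(G))$ is the diameter of this graph. The tree-depth of $G$ is the minimum height of a search tree on $G$, where a tree consisting of a single vertex has height one.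
   Formalization: The formal theorem assumes 2 ≤ td(n) ≤ n for all large n: for td(n) = 1 and n ≥ 2 the family is empty, and for td(n) = n² the claim fails since tree-depth is at most n, so all diameters are O(n²). -}

module Defs where

open import Data.Nat using (ℕ; zero; suc; _≤_; _⊔_)
open import Data.Bool using (Bool; true; false)
open import Data.Fin using (Fin)
open import Data.Fin.Subset using (Subset; _∈_; _∉_; _⊆_; _-_; ⊤; Nonempty)
open import Data.List using (List; []; _∷_; _++_)
open import Data.List.Relation.Unary.All using (All)
open import Data.List.Relation.Unary.Any using (Any)
open import Data.List.Relation.Unary.AllPairs using (AllPairs)
import Data.List.Membership.Propositional as L
open import Data.Product using (Σ; _×_; _,_; proj₁; ∃)
open import Data.Sum using (_⊎_)
open import Relation.Binary.PropositionalEquality using (_≡_; _≢_)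
open import Relation.Nullary using (¬_)

record Graph (n : ℕ) : Set where
  field
    adj    : Fin n → Fin n → Bool
    sym    : ∀ i j → adj i j ≡ adj j i
    irrefl : ∀ i → adj i i ≡ false
open Graph public

module _ {n : ℕ} (G : Graph n) where

  Adjacent : Fin n → Fin n → Set
  Adjacent u v = adj G u v ≡ true

  data PathIn (C : Subset n) : Fin n → Fin n → Set where
    stop : ∀ {u} → u ∈ C → PathIn C u u
    step : ∀ {u w v} → u ∈ C → Adjacent u w → PathIn C w v → PathIn C u v

  ConnectedIn : Subset n → Set
  ConnectedIn C = ∀ u v → u ∈ C → v ∈ C → PathIn C u v

  Connected : Set
  Connected = ConnectedIn ⊤

  IsComponent : Subset n → Subset n → Set
  IsComponent S C =
    Nonempty C × C ⊆ S × ConnectedIn C ×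
    (∀ u v → u ∈ C → v ∈ S → v ∉ C → ¬ Adjacent u v)

  Disjoint : Subset n → Subset n → Set
  Disjoint C D = ∀ v → v ∈ C → v ∉ D

  -- Search trees on G[S]: a root r ∈ S joined to search trees on each
  -- connected component of G[S] - r (the children's vertex sets are
  -- components of G[S] - r, pairwise disjoint and covering S - r).
  data SearchTree (S : Subset n) : Set where
    node : (r : Fin n) → r ∈ S →
           (cs : List (Σ (Subset n) SearchTree)) →
           All (λ c → IsComponent (S - r) (proj₁ c)) cs →
           AllPairs (λ c d → Disjoint (proj₁ c) (proj₁ d)) cs →
           (∀ v → v ∈ S - r → Any (λ c → v ∈ proj₁ c) cs) →
           SearchTree S

  mutual
    tubes : ∀ {S} → SearchTree S → List (Subset n)
    tubes {S} (node _ _ cs _ _ _) = S ∷ tubesList cs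

    tubesList : List (Σ (Subset n) SearchTree) → List (Subset n)
    tubesList [] = []
    tubesList ((_ , t) ∷ cs) = tubes t ++ tubesList cs

  -- height (a single vertex has height one)
  mutual
    height : ∀ {S} → SearchTree S → ℕ
    height (node _ _ cs _ _ _) = suc (heightList cs)

    heightList : List (Σ (Subset n) SearchTree) → ℕ
    heightList [] = 0
    heightList ((_ , t) ∷ cs) = height t ⊔ heightList cs

  ST : Set
  ST = SearchTree ⊤

  InSymDiff : ST → ST → Subset n → Set
  InSymDiff T T' X =
    (X L.∈ tubes T × ¬ X L.∈ tubes T') ⊎ (X L.∈ tubes T' × ¬ X L.∈ tubes T)

  Rotation : ST → ST → Set
  Rotation T T' =
    Σ (Subset n) λ X → Σ (Subset n) λ Y →
      X ≢ Y × InSymDiff T T' X × InSymDiff T T' Y ×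
      (∀ Z → InSymDiff T T' Z → Z ≡ X ⊎ Z ≡ Y)

  -- same search tree (same set of tubes)
  SameTubes : ST → ST → Set
  SameTubes T T' = (∀ X → X L.∈ tubes T → X L.∈ tubes T') ×
                   (∀ X → X L.∈ tubes T' → X L.∈ tubes T)

  data Reach (T : ST) : ST → ℕ → Set where
    same : ∀ {T'} → SameTubes T T' → Reach T T' 0
    step : ∀ {T' T'' k} → Reach T T' k → Rotation T' T'' → Reach T T'' (suc k)

  DiamAtMost : ℕ → Set
  DiamAtMost d = ∀ (T T' : ST) → ∃ λ k → k ≤ d × Reach T T' k

  DiamAtLeast : ℕ → Set
  DiamAtLeast d = Σ ST λ T → Σ ST λ T' → ∀ k → Reach T T' k → d ≤ k

  TreeDepthAtMost : ℕ → Set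
  TreeDepthAtMost t = Σ ST λ T → height T ≤ t

InFamily : (td : ℕ → ℕ) (n : ℕ) → Graph n → Set
InFamily td n G = Connected G × TreeDepthAtMost G (td n)

{-# OPTIONS --safe #-}
module Submission where

open import Defs
open import Data.Bool using (Bool; true; false; not; _xor_)
import Data.Bool.Properties as Bool
open import Data.Empty using (⊥-elim)
open import Data.Fin using (Fin; zero; suc; _↑ˡ_; _↑ʳ_; combine; remQuot; splitAt)
import Data.Fin.Properties as Fin
open import Data.Fin.Subset using (Subset; _∈_; _∉_; _⊆_; _-_; _─_; ⊤; ⁅_⁆; ⋃; ∣_∣; Nonempty; inside; outside)
open import Data.Fin.Subset.Properties
open import Data.List using (List; []; _∷_; _++_; map; filter; length; tabulate)
open import Data.List.Properties using (length-tabulate)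
import Data.List.Membership.Propositional as L
open import Data.List.Membership.Propositional.Properties using (∈-++⁺ˡ; ∈-++⁺ʳ; ∈-++⁻; ∈-∃++; ∈-map⁺; ∈-map⁻; ∈-filter⁺; ∈-filter⁻; ∈-tabulate⁺)
open import Data.List.Relation.Binary.Permutation.Propositional using (_↭_; ↭-sym; ↭⇒↭ₛ)
open import Data.List.Relation.Binary.Permutation.Propositional.Properties using (All-resp-↭; Any-resp-↭; shift)
open import Data.List.Relation.Binary.Permutation.Setoid.Properties using (AllPairs-resp-↭)
open import Data.List.Relation.Unary.All as All using (All; []; _∷_)
import Data.List.Relation.Unary.All.Properties as All
open import Data.List.Relation.Unary.AllPairs as AllPairs using (AllPairs; []; _∷_)
import Data.List.Relation.Unary.AllPairs.Properties as AllPairs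
open import Data.List.Relation.Unary.Any using (Any; here; there)
open import Data.Nat using (ℕ; zero; suc; _+_; _∸_; _*_; _≤_; _⊔_; _⊓_; z≤n; s≤s; ⌊_/2⌋; ⌈_/2⌉)
open import Data.Nat.Properties
open import Data.Product as Product using (Σ; ∃; _×_; _,_; proj₁; proj₂)
open import Data.Sum as Sum using (_⊎_; inj₁; inj₂; [_,_]′)
open import Data.Vec using ([]; _∷_)
open import Data.Vec.Base using (here; there)
open import Function using (_∘_; id)
open import Relation.Binary.PropositionalEquality using (_≡_; _≢_; refl; trans; cong; cong₂; subst; resp₂; setoid) renaming (sym to ≡-sym)
open import Relation.Nullary using (¬_; Dec; yes; no; contradiction; ¬?; _×-dec_)

-- Upper bound: a vertex r of a tube S can be rotated up to the root of a search tree on S in at most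
-- ∣S∣ rotations. Doing this for the root of a tree T* of minimum height and recursing into the
-- components turns any tree into T* with at most Σ ∣X∣ rotations, X running over the tubes of T*.
-- This sum counts the vertices with their depths in T*, so it is at most td · n, and any two trees
-- are at distance at most 2 · td · n.
--
-- Lower bound: of two adjacent vertices, one is above the other in every search tree, and in a
-- complete bipartite graph a rotation reverses at most one edge. With p ≤ td - 1 vertices on one side
-- and q on the other, take the tree with the p vertices as a chain on top of q leaves and the
-- tree with the roles exchanged: all p · q edges are reversed between them.

-- Differences and unions of finite subsets.

x∈p─q⇒x∉q : ∀ {n x} (p q : Subset n) → x ∈ p ─ q → x ∉ q
x∈p─q⇒x∉q (inside  ∷ p) (inside ∷ q) () here
x∈p─q⇒x∉q (outside ∷ p) (inside ∷ q) () here
x∈p─q⇒x∉q (_ ∷ p) (outside ∷ q) (there h) (there k) = x∈p─q⇒x∉q p q h k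
x∈p─q⇒x∉q (_ ∷ p) (inside  ∷ q) (there h) (there k) = x∈p─q⇒x∉q p q h k

x∉p-x : ∀ {n} (p : Subset n) x → x ∉ p - x
x∉p-x p x h = x∈p─q⇒x∉q p ⁅ x ⁆ h (x∈⁅x⁆ x)

x∈p-y⇒x≢y : ∀ {n x y} (p : Subset n) → x ∈ p - y → x ≢ y
x∈p-y⇒x≢y p h refl = x∉p-x p _ h

p-x⊆p : ∀ {n} (p : Subset n) x → p - x ⊆ p
p-x⊆p p x = p─q⊆p p ⁅ x ⁆

x∈p∧x∉p─q⇒x∈q : ∀ {n x} (p q : Subset n) → x ∈ p → x ∉ p ─ q → x ∈ q
x∈p∧x∉p─q⇒x∈q {x = x} p q h k with x ∈? q
... | yes x∈q = x∈q
... | no x∉q = contradiction (x∈p∧x∉q⇒x∈p─q h x∉q) k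

∣q∣+∣p─q∣≤∣p∣ : ∀ {n} (p q : Subset n) → q ⊆ p → ∣ q ∣ + ∣ p ─ q ∣ ≤ ∣ p ∣
∣q∣+∣p─q∣≤∣p∣ [] [] _ = z≤n
∣q∣+∣p─q∣≤∣p∣ (inside ∷ p) (inside ∷ q) q⊆p = s≤s (∣q∣+∣p─q∣≤∣p∣ p q (drop-∷-⊆ q⊆p))
∣q∣+∣p─q∣≤∣p∣ (outside ∷ p) (inside ∷ q) q⊆p = contradiction (q⊆p here) λ ()
∣q∣+∣p─q∣≤∣p∣ (outside ∷ p) (outside ∷ q) q⊆p = ∣q∣+∣p─q∣≤∣p∣ p q (drop-∷-⊆ q⊆p)
∣q∣+∣p─q∣≤∣p∣ (inside ∷ p) (outside ∷ q) q⊆p =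
  ≤-trans (≤-reflexive (+-suc ∣ q ∣ _)) (s≤s (∣q∣+∣p─q∣≤∣p∣ p q (drop-∷-⊆ q⊆p)))

∈-⋃⁺ : ∀ {n x p} {ps : List (Subset n)} → p L.∈ ps → x ∈ p → x ∈ ⋃ ps
∈-⋃⁺ (here refl) x∈p = x∈p∪q⁺ (inj₁ x∈p)
∈-⋃⁺ (there p∈ps) x∈p = x∈p∪q⁺ (inj₂ (∈-⋃⁺ p∈ps x∈p))

∈-⋃⁻ : ∀ {n x} (ps : List (Subset n)) → x ∈ ⋃ ps → ∃ λ p → p L.∈ ps × x ∈ p
∈-⋃⁻ [] x∈ = contradiction x∈ ∉⊥
∈-⋃⁻ (p ∷ ps) x∈ with x∈p∪q⁻ p (⋃ ps) x∈
... | inj₁ x∈p = p , here refl , x∈p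
... | inj₂ x∈ps with ∈-⋃⁻ ps x∈ps
...   | q , q∈ps , x∈q = q , there q∈ps , x∈q

-- Sets of tubes up to rotation

module _ {A : Set} where

  _≋_ : List A → List A → Set
  xs ≋ ys = (∀ X → X L.∈ xs → X L.∈ ys) × (∀ X → X L.∈ ys → X L.∈ xs)

  _∖_∋_ : List A → List A → A → Set
  xs ∖ ys ∋ X = X L.∈ xs × ¬ X L.∈ ys

  SymDiff : List A → List A → A → Set
  SymDiff xs ys X = xs ∖ ys ∋ X ⊎ ys ∖ xs ∋ X

  -- `Rotation` with the trees replaced by arbitrary lists, so that it also applies to forests and
  -- to trees on a subset. On `tubes G T` and `tubes G T′` it unfolds to `Rotation G T T′`, which
  -- `reach` relies on.
  Flip : List A → List A → Set
  Flip xs ys = Σ A λ X → Σ A λ Y →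
    X ≢ Y × SymDiff xs ys X × SymDiff xs ys Y × (∀ Z → SymDiff xs ys Z → Z ≡ X ⊎ Z ≡ Y)

  ≋-refl : ∀ {xs} → xs ≋ xs
  ≋-refl = (λ _ → id) , (λ _ → id)

  ≋-sym : ∀ {xs ys} → xs ≋ ys → ys ≋ xs
  ≋-sym (f , g) = g , f

  ≋-trans : ∀ {xs ys zs} → xs ≋ ys → ys ≋ zs → xs ≋ zs
  ≋-trans (f , g) (h , k) = (λ X → h X ∘ f X) , (λ X → g X ∘ k X)

  ≋-∷ : ∀ {x xs ys} → xs ≋ ys → (x ∷ xs) ≋ (x ∷ ys)
  ≋-∷ (f , g) = (λ { X (here p) → here p ; X (there h) → there (f X h) }) ,
                (λ { X (here p) → here p ; X (there h) → there (g X h) })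

  SymDiff-resp-≋ : ∀ {xs xs′ ys ys′} → xs ≋ xs′ → ys ≋ ys′ → ∀ {X} → SymDiff xs ys X → SymDiff xs′ ys′ X
  SymDiff-resp-≋ (f , g) (h , k) = Sum.map (λ (p , q) → f _ p , q ∘ k _) (λ (p , q) → h _ p , q ∘ g _)

  Flip-resp-≋ : ∀ {xs xs′ ys ys′} → xs ≋ xs′ → ys ≋ ys′ → Flip xs ys → Flip xs′ ys′
  Flip-resp-≋ e e′ (X , Y , X≢Y , dX , dY , only) =
    X , Y , X≢Y , SymDiff-resp-≋ e e′ dX , SymDiff-resp-≋ e e′ dY ,
    λ Z dZ → only Z (SymDiff-resp-≋ (≋-sym e) (≋-sym e′) dZ)

  Flip-sym : ∀ {xs ys} → Flip xs ys → Flip ys xs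
  Flip-sym (X , Y , X≢Y , dX , dY , only) =
    X , Y , X≢Y , Sum.swap dX , Sum.swap dY , λ Z → only Z ∘ Sum.swap

  -- A flip has two differing elements. The gained `Y` is one of them and equals no lost element, so
  -- one place is left for `X` and `X′`.
  lost-unique : ∀ {xs ys X X′ Y} → Flip xs ys → xs ∖ ys ∋ X → xs ∖ ys ∋ X′ → ys ∖ xs ∋ Y → X ≡ X′
  lost-unique {X = X} {X′} {Y} (_ , _ , _ , _ , _ , only) lost@(X∈ , _) lost′@(X′∈ , _) gained@(_ , Y∉)
    with only X (inj₁ lost) | only X′ (inj₁ lost′) | only Y (inj₂ gained)
  ... | inj₁ refl | inj₁ refl | _         = refl
  ... | inj₂ refl | inj₂ refl | _         = refl
  ... | inj₁ refl | inj₂ refl | inj₁ refl = contradiction X∈ Y∉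
  ... | inj₁ refl | inj₂ refl | inj₂ refl = contradiction X′∈ Y∉
  ... | inj₂ refl | inj₁ refl | inj₁ refl = contradiction X′∈ Y∉
  ... | inj₂ refl | inj₁ refl | inj₂ refl = contradiction X∈ Y∉

  -- A frame condition: `xs′` consists of `xs` and, disjointly, a context `Q`. Lists that change
  -- inside the same context have the same symmetric difference with and without it.
  record _⊎[_]≋_ (xs : List A) (Q : A → Set) (xs′ : List A) : Set where
    field
      split : ∀ {Z} → Z L.∈ xs′ → Z L.∈ xs ⊎ Q Z
      inˡ   : ∀ {Z} → Z L.∈ xs → Z L.∈ xs′
      inʳ   : ∀ {Z} → Q Z → Z L.∈ xs′
      apart : ∀ {Z} → Z L.∈ xs → ¬ Q Z

  open _⊎[_]≋_

  module _ {Q : A → Set} {xs ys xs′ ys′ : List A} (ex : xs ⊎[ Q ]≋ xs′) (ey : ys ⊎[ Q ]≋ ys′) where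

    ≋-frame : xs ≋ ys → xs′ ≋ ys′
    ≋-frame (f , g) =
      (λ X → [ inˡ ey ∘ f X , inʳ ey ]′ ∘ split ex) , (λ X → [ inˡ ex ∘ g X , inʳ ex ]′ ∘ split ey)

    SymDiff-frame⁺ : ∀ {X} → SymDiff xs ys X → SymDiff xs′ ys′ X
    SymDiff-frame⁺ (inj₁ (p , q)) = inj₁ (inˡ ex p , λ h → [ q , apart ex p ]′ (split ey h))
    SymDiff-frame⁺ (inj₂ (p , q)) = inj₂ (inˡ ey p , λ h → [ q , apart ey p ]′ (split ex h))

    SymDiff-frame⁻ : ∀ {X} → SymDiff xs′ ys′ X → SymDiff xs ys X
    SymDiff-frame⁻ (inj₁ (p , q)) = inj₁ ([ id , ⊥-elim ∘ q ∘ inʳ ey ]′ (split ex p) , q ∘ inˡ ey)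
    SymDiff-frame⁻ (inj₂ (p , q)) = inj₂ ([ id , ⊥-elim ∘ q ∘ inʳ ex ]′ (split ey p) , q ∘ inˡ ex)

    Flip-frame : Flip xs ys → Flip xs′ ys′
    Flip-frame (X , Y , X≢Y , dX , dY , only) =
      X , Y , X≢Y , SymDiff-frame⁺ dX , SymDiff-frame⁺ dY , λ Z → only Z ∘ SymDiff-frame⁻

  ++-frameˡ : ∀ {xs} ys → (∀ {Z} → Z L.∈ xs → ¬ Z L.∈ ys) → xs ⊎[ L._∈ ys ]≋ (xs ++ ys)
  ++-frameˡ {xs} ys d = record
    { split = ∈-++⁻ xs ; inˡ = ∈-++⁺ˡ ; inʳ = ∈-++⁺ʳ xs ; apart = d }

  ++-frameʳ : ∀ ys {xs} → (∀ {Z} → Z L.∈ xs → ¬ Z L.∈ ys) → xs ⊎[ L._∈ ys ]≋ (ys ++ xs)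
  ++-frameʳ ys d = record
    { split = Sum.swap ∘ ∈-++⁻ ys ; inˡ = ∈-++⁺ʳ ys ; inʳ = ∈-++⁺ˡ ; apart = d }

  -- `Reach` for any objects whose tubes are read off by `f`; the induction for the upper bound
  -- walks through trees on subsets and through forests.
  data Walk {B : Set} (f : B → List A) : B → B → ℕ → Set where
    same : ∀ {a b} → f a ≋ f b → Walk f a b 0
    step : ∀ {a b c k} → Walk f a b k → Flip (f b) (f c) → Walk f a c (suc k)

  module _ {B : Set} {f : B → List A} where

    walk-≋ʳ : ∀ {a b c k} → Walk f a b k → f b ≋ f c → Walk f a c k
    walk-≋ʳ (same e) e′ = same (≋-trans e e′)
    walk-≋ʳ (step w r) e = step w (Flip-resp-≋ ≋-refl e r)

    walk-≋ˡ : ∀ {a b c k} → f a ≋ f b → Walk f b c k → Walk f a c k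
    walk-≋ˡ e (same e′) = same (≋-trans e e′)
    walk-≋ˡ e (step w r) = step (walk-≋ˡ e w) r

    walk-trans : ∀ {a b c j k} → Walk f a b j → Walk f b c k → Walk f a c (k + j)
    walk-trans w (same e) = walk-≋ʳ w e
    walk-trans w (step v r) = step (walk-trans w v) r

    walk-sym : ∀ {a b k} → Walk f a b k → Walk f b a k
    walk-sym (same e) = same (≋-sym e)
    walk-sym {k = suc k} (step w r) =
      subst (Walk f _ _) (+-comm k 1) (walk-trans (step (same ≋-refl) (Flip-sym r)) (walk-sym w))

  -- A fixed context turns each flip into a flip, so the local walk lifts without a change of
  -- length.
  walk-frame : ∀ {B B′ : Set} {f : B → List A} {f′ : B′ → List A} {Q : A → Set} (g : B → B′) →
    (∀ b → f b ⊎[ Q ]≋ f′ (g b)) → ∀ {a b k} → Walk f a b k → Walk f′ (g a) (g b) k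
  walk-frame g e (same eq) = same (≋-frame (e _) (e _) eq)
  walk-frame g e (step w r) = step (walk-frame g e w) (Flip-frame (e _) (e _) r)

-- Search forests

module _ {n : ℕ} (G : Graph n) where

  private
    variable
      S C D : Subset n
      u v w : Fin n

  -- Paths and connected components.

  adjacent-sym : Adjacent G u v → Adjacent G v u
  adjacent-sym {u} {v} a = trans (Graph.sym G v u) a

  path-start : PathIn G C u v → u ∈ C
  path-start (stop u∈) = u∈
  path-start (step u∈ _ _) = u∈

  path-trans : PathIn G C u v → PathIn G C v w → PathIn G C u w
  path-trans (stop _) q = q
  path-trans (step u∈ a p) q = step u∈ a (path-trans p q)

  path-sym : PathIn G C u v → PathIn G C v u
  path-sym (stop u∈) = stop u∈
  path-sym (step u∈ a p) = path-trans (path-sym p) (step (path-start p) (adjacent-sym a) (stop u∈))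

  path-mono : C ⊆ D → PathIn G C u v → PathIn G D u v
  path-mono C⊆D (stop u∈) = stop (C⊆D u∈)
  path-mono C⊆D (step u∈ a p) = step (C⊆D u∈) a (path-mono C⊆D p)

  component-⊆ : IsComponent G S C → C ⊆ S
  component-⊆ (_ , C⊆S , _) = C⊆S

  component-closed : IsComponent G S C → u ∈ C → v ∈ S → Adjacent G u v → v ∈ C
  component-closed {C = C} {u} {v} (_ , _ , _ , closed) u∈C v∈S a with v ∈? C
  ... | yes v∈C = v∈C
  ... | no v∉C = contradiction a (closed u v u∈C v∈S v∉C)

  path-stays : IsComponent G S D → C ⊆ S → PathIn G C u v → u ∈ D → v ∈ D
  path-stays D-comp C⊆S (stop _) u∈D = u∈D
  path-stays D-comp C⊆S (step _ a p) u∈D =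
    path-stays D-comp C⊆S p (component-closed D-comp u∈D (C⊆S (path-start p)) a)

  component-unique : IsComponent G S C → IsComponent G S D → v ∈ C → v ∈ D → C ≡ D
  component-unique Cc@(_ , C⊆S , C-conn , _) Dc@(_ , D⊆S , D-conn , _) v∈C v∈D = ⊆-antisym
    (λ u∈C → path-stays Dc C⊆S (C-conn _ _ v∈C u∈C) v∈D)
    (λ u∈D → path-stays Cc D⊆S (D-conn _ _ v∈D u∈D) v∈C)

  -- Follow a path in `S` from `C` to `r`. Until it first arrives at `r` it runs in `S - r`, hence
  -- stays in `C`; the vertex just before that arrival is the witness.
  component-touches : ∀ {r} → ConnectedIn G S → r ∈ S → IsComponent G (S - r) C →
    ∃ λ w → w ∈ C × Adjacent G w r
  component-touches {S} {C} {r} conn r∈S comp@((u , u∈C) , C⊆ , _) =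
    go (conn u r (p-x⊆p S r (C⊆ u∈C)) r∈S) u∈C
    where
    go : ∀ {u} → PathIn G S u r → u ∈ C → ∃ λ w → w ∈ C × Adjacent G w r
    go (stop _) r∈C = contradiction (C⊆ r∈C) (x∉p-x S r)
    go {u} (step {w = w} _ a p) u∈C with w Fin.≟ r
    ... | yes refl = u , u∈C , a
    ... | no w≢r = go p (component-closed comp u∈C (x∈p∧x≢y⇒x∈p-y (path-start p) w≢r) a)

  -- Trees as a root over a forest, and their tubes.

  Tree : Subset n → Set
  Tree = SearchTree G

  Child : Set
  Child = Σ (Subset n) Tree

  -- The arguments of `node` below the root, packaged for an arbitrary `S`, so that children can be
  -- split off, regrouped and put under another root.
  record Forest (S : Subset n) : Set where
    constructor forest
    field
      trees : List Child
      comps : All (λ c → IsComponent G S (proj₁ c)) trees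
      disj  : AllPairs (λ c d → Disjoint G (proj₁ c) (proj₁ d)) trees
      cover : ∀ v → v ∈ S → Any (λ c → v ∈ proj₁ c) trees

  open Forest

  graft : ∀ r → r ∈ S → Forest (S - r) → Tree S
  graft r r∈S (forest cs a p c) = node r r∈S cs a p c

  treeTubes : Tree S → List (Subset n)
  treeTubes = tubes G

  forestTubes : Forest S → List (Subset n)
  forestTubes F = tubesList G (trees F)

  module _ (P : ∀ {S} → Tree S → Set)
           (ind : ∀ {S} r (r∈S : r ∈ S) (F : Forest (S - r)) →
                  All (λ c → P (proj₂ c)) (trees F) → P (graft r r∈S F)) where

    -- The recursion through the list of children is carried out once here; later inductions only
    -- see a root, a forest and the hypotheses on its trees.
    tree-ind : (t : Tree S) → P t
    trees-ind : (cs : List Child) → All (λ c → P (proj₂ c)) cs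
    tree-ind (node r r∈S cs a p c) = ind r r∈S (forest cs a p c) (trees-ind cs)
    trees-ind [] = []
    trees-ind ((_ , t) ∷ cs) = tree-ind t ∷ trees-ind cs

  ∈-tubesList⁺ : ∀ {X c cs} → c L.∈ cs → X L.∈ treeTubes (proj₂ c) → X L.∈ tubesList G cs
  ∈-tubesList⁺ (here refl) h = ∈-++⁺ˡ h
  ∈-tubesList⁺ {cs = (_ , t) ∷ _} (there c∈) h = ∈-++⁺ʳ (treeTubes t) (∈-tubesList⁺ c∈ h)

  ∈-tubesList⁻ : ∀ {X} cs → X L.∈ tubesList G cs → ∃ λ c → c L.∈ cs × X L.∈ treeTubes (proj₂ c)
  ∈-tubesList⁻ ((_ , t) ∷ cs) h with ∈-++⁻ (treeTubes t) h
  ... | inj₁ h₁ = _ , here refl , h₁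
  ... | inj₂ h₂ with ∈-tubesList⁻ cs h₂
  ...   | c , c∈ , h₃ = c , there c∈ , h₃

  findTree : (F : Forest S) → v ∈ S →
    ∃ λ c → c L.∈ trees F × IsComponent G S (proj₁ c) × v ∈ proj₁ c
  findTree F v∈S with L.find (cover F _ v∈S)
  ... | c , c∈ , v∈c = c , c∈ , All.lookup (comps F) c∈ , v∈c

  S∈tubes : (t : Tree S) → S L.∈ treeTubes t
  S∈tubes (node _ _ _ _ _ _) = here refl

  tube-⊆ : ∀ {X} (t : Tree S) → X L.∈ treeTubes t → X ⊆ S
  tube-⊆ {X = X} = tree-ind (λ {S} t → X L.∈ treeTubes t → X ⊆ S) λ where
    r r∈S F ih (here refl) → id
    {S} r r∈S F ih (there h) → let (c , c∈ , h′) = ∈-tubesList⁻ (trees F) h in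
      p-x⊆p S r ∘ component-⊆ (All.lookup (comps F) c∈) ∘ All.lookup ih c∈ h′

  tube-nonempty : ∀ {X} (t : Tree S) → X L.∈ treeTubes t → Nonempty X
  tube-nonempty {X = X} = tree-ind (λ t → X L.∈ treeTubes t → Nonempty X) λ where
    r r∈S F ih (here refl) → r , r∈S
    r r∈S F ih (there h) → let (c , c∈ , h′) = ∈-tubesList⁻ (trees F) h in All.lookup ih c∈ h′

  forest-tube-⊆ : ∀ {X} (F : Forest S) → X L.∈ forestTubes F → X ⊆ S
  forest-tube-⊆ F h with ∈-tubesList⁻ (trees F) h
  ... | (_ , t) , c∈ , h′ = component-⊆ (All.lookup (comps F) c∈) ∘ tube-⊆ t h′

  -- Splitting a component off a forest.

  cons : IsComponent G S C → Tree C → Forest (S ─ C) → Forest S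
  cons {S} {C} C-comp t (forest cs a p cov) = forest ((C , t) ∷ cs) (C-comp ∷ All.map widen a)
    (All.map (λ (_ , D⊆ , _) v v∈C v∈D → x∈p─q⇒x∉q S C (D⊆ v∈D) v∈C) a ∷ p) cov′
    where
    -- No edge joins `C` to `S ─ C`, so enlarging `S ─ C` to `S` gives `D` no new neighbours.
    widen : ∀ {D} → IsComponent G (S ─ C) D → IsComponent G S D
    widen D-comp@(ne , D⊆ , conn , closed) = ne , p─q⊆p S C ∘ D⊆ , conn , closed′
      where
      closed′ : ∀ u v → _ → _ → _ → ¬ _
      closed′ u v u∈D v∈S v∉D a with v ∈? C
      ... | yes v∈C = x∈p─q⇒x∉q S C (D⊆ u∈D)
                        (component-closed C-comp v∈C (p─q⊆p S C (D⊆ u∈D)) (adjacent-sym a))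
      ... | no v∉C = closed u v u∈D (x∈p∧x∉q⇒x∈p─q v∈S v∉C) v∉D a
    cov′ : ∀ v → v ∈ S → Any (λ c → v ∈ proj₁ c) ((C , t) ∷ cs)
    cov′ v v∈S with v ∈? C
    ... | yes v∈C = here v∈C
    ... | no v∉C = there (cov v (x∈p∧x∉q⇒x∈p─q v∈S v∉C))

  uncons : ∀ {c cs} (F : Forest S) → trees F ≡ c ∷ cs →
    IsComponent G S (proj₁ c) × Σ (Forest (S ─ proj₁ c)) λ F′ → trees F′ ≡ cs
  uncons {S} {C , t} {cs} (forest _ (C-comp ∷ a) (d ∷ p) cov) refl =
    C-comp , forest cs (All.zipWith narrow (a , d)) p cov′ , refl
    where
    narrow : ∀ {D} → IsComponent G S D × Disjoint G C D → IsComponent G (S ─ C) D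
    narrow ((ne , D⊆S , conn , closed) , disjoint) =
      ne , (λ v∈D → x∈p∧x∉q⇒x∈p─q (D⊆S v∈D) (λ v∈C → disjoint _ v∈C v∈D)) , conn ,
      λ u v u∈D v∈ → closed u v u∈D (p─q⊆p S C v∈)
    cov′ : ∀ v → v ∈ S ─ C → Any (λ c → v ∈ proj₁ c) cs
    cov′ v v∈ with cov v (p─q⊆p S C v∈)
    ... | here v∈C = contradiction v∈C (x∈p─q⇒x∉q S C v∈)
    ... | there h = h

  permute : ∀ {cs} (F : Forest S) → trees F ↭ cs → Σ (Forest S) λ F′ → trees F′ ≡ cs
  permute (forest _ a p cov) σ =
    forest _ (All-resp-↭ σ a)
      (AllPairs-resp-↭ (setoid Child) (λ d v v∈C v∈D → d v v∈D v∈C) (resp₂ _) (↭⇒↭ₛ σ) p)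
      (λ v v∈S → Any-resp-↭ σ (cov v v∈S)) , refl

  tubesList-↭ : ∀ {cs ds} → cs ↭ ds → ∀ X → X L.∈ tubesList G cs → X L.∈ tubesList G ds
  tubesList-↭ σ X h with ∈-tubesList⁻ _ h
  ... | c , c∈ , h′ = ∈-tubesList⁺ (Any-resp-↭ σ c∈) h′

  -- Only the set of tubes matters, so the child may be permuted to the front of the list and
  -- removed by `uncons`.
  extract : ∀ {c} (F : Forest S) → c L.∈ trees F → Σ (IsComponent G S (proj₁ c)) λ C-comp →
    Σ (Forest (S ─ proj₁ c)) λ F′ → forestTubes F ≋ forestTubes (cons C-comp (proj₂ c) F′)
  extract {c = c} F c∈ with ∈-∃++ c∈
  ... | xs , ys , refl with permute F (shift c xs ys)
  ...   | F₁ , eq with uncons F₁ eq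
  ...     | C-comp , F′ , refl = C-comp , F′ ,
            tubesList-↭ (shift c xs ys) , tubesList-↭ (↭-sym (shift c xs ys))

  -- Walks inside a larger tree, and a single rotation.

  graft-walk : ∀ {r} (r∈S : r ∈ S) {F F′ : Forest (S - r)} {k} →
    Walk forestTubes F F′ k → Walk treeTubes (graft r r∈S F) (graft r r∈S F′) k
  graft-walk {S} {r} r∈S = walk-frame (graft r r∈S) λ F →
    -- The context is the one tube `S`; it contains `r`, unlike every tube of a forest on `S - r`.
    ++-frameʳ (S ∷ []) λ where h (here refl) → x∉p-x S r (forest-tube-⊆ F h r∈S)

  -- The two sides live on disjoint vertex sets, and tubes are nonempty.
  tubes-apart : ∀ {X} (t : Tree C) (F : Forest (S ─ C)) → X L.∈ treeTubes t → ¬ X L.∈ forestTubes F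
  tubes-apart {C} {S} t F h h′ with tube-nonempty t h
  ... | v , v∈X = x∈p─q⇒x∉q S C (forest-tube-⊆ F h′ v∈X) (tube-⊆ t h v∈X)

  cons-walkˡ : (C-comp : IsComponent G S C) (F : Forest (S ─ C)) {t t′ : Tree C} → ∀ {k} →
    Walk treeTubes t t′ k → Walk forestTubes (cons C-comp t F) (cons C-comp t′ F) k
  cons-walkˡ C-comp F = walk-frame (λ t → cons C-comp t F) λ t →
    ++-frameˡ (forestTubes F) (tubes-apart t F)

  cons-walkʳ : (C-comp : IsComponent G S C) (t : Tree C) {F F′ : Forest (S ─ C)} → ∀ {k} →
    Walk forestTubes F F′ k → Walk forestTubes (cons C-comp t F) (cons C-comp t F′) k
  cons-walkʳ C-comp t = walk-frame (cons C-comp t) λ F →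
    ++-frameʳ (treeTubes t) (λ h h′ → tubes-apart t F h′ h)

  -- In the tree with root r₀ whose child on C has root r, the subtrees of that child that are not
  -- adjacent to r₀ stay below r; everything else moves below r₀, on the vertex set M.
  module Rotate {S C : Subset n} {r₀ r : Fin n} (S-conn : ConnectedIn G S) (r₀∈S : r₀ ∈ S)
                (C-comp : IsComponent G (S - r₀) C) (r∈C : r ∈ C)
                (E : Forest (C - r)) (R : Forest ((S - r₀) ─ C)) where

    before : Forest (S - r₀)
    before = cons C-comp (graft r r∈C E) R

    C⊆S-r₀ : C ⊆ S - r₀
    C⊆S-r₀ = component-⊆ C-comp

    C⊆S : C ⊆ S
    C⊆S = p-x⊆p S r₀ ∘ C⊆S-r₀

    r∈S : r ∈ S
    r∈S = C⊆S r∈C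

    r₀∉C : r₀ ∉ C
    r₀∉C = x∉p-x S r₀ ∘ C⊆S-r₀

    r₀≢r : r₀ ≢ r
    r₀≢r refl = r₀∉C r∈C

    Touches : Subset n → Set
    Touches X = ∃ λ w → w ∈ X × Adjacent G w r₀

    touches? : (c : Child) → Dec (Touches (proj₁ c))
    touches? (X , _) = Fin.any? λ w → (w ∈? X) ×-dec (adj G w r₀ Bool.≟ true)

    -- Named after the position reached by the rotation: `lower` hangs below `r₀`, `upper` directly
    -- below `r`.
    lower upper : List Child
    lower = filter touches? (trees E)
    upper = filter (¬? ∘ touches?) (trees E)

    -- The component of `S - r` containing `r₀` (see `M-comp`), obtained by taking away the
    -- components that `r₀` has no edge to.
    M : Subset n
    M = (S - r) ─ ⋃ (map proj₁ upper)

    ∉-upper : v ∉ ⋃ (map proj₁ upper) → ∀ {c} → c L.∈ upper → v ∉ proj₁ c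
    ∉-upper v∉ c∈ v∈c = v∉ (∈-⋃⁺ (∈-map⁺ proj₁ c∈) v∈c)

    ∈-M : v ∈ S - r → (∀ {c} → c L.∈ upper → v ∉ proj₁ c) → v ∈ M
    ∈-M v∈ v∉upper = x∈p∧x∉q⇒x∈p─q v∈ v∉⋃
      where
      v∉⋃ : _
      v∉⋃ h with ∈-⋃⁻ (map proj₁ upper) h
      ... | p , p∈ , v∈p with ∈-map⁻ proj₁ p∈
      ...   | c , c∈ , refl = v∉upper c∈ v∈p

    M⊆S-r : M ⊆ S - r
    M⊆S-r = p─q⊆p (S - r) _

    M⊆S : M ⊆ S
    M⊆S = p-x⊆p S r ∘ M⊆S-r

    M∩upper : v ∈ M → ∀ {c} → c L.∈ upper → v ∉ proj₁ c
    M∩upper v∈M = ∉-upper (x∈p─q⇒x∉q (S - r) _ v∈M)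

    upper⊆E : ∀ {c} → c L.∈ upper → c L.∈ trees E
    upper⊆E = proj₁ ∘ ∈-filter⁻ (¬? ∘ touches?)

    lower⊆E : ∀ {c} → c L.∈ lower → c L.∈ trees E
    lower⊆E = proj₁ ∘ ∈-filter⁻ touches?

    E-comp : ∀ {c} → c L.∈ trees E → IsComponent G (C - r) (proj₁ c)
    E-comp = All.lookup (comps E)

    R-comp : ∀ {c} → c L.∈ trees R → IsComponent G (S - r₀) (proj₁ c)
    R-comp c∈ = All.lookup (comps before) (there c∈)

    E⊆C : ∀ {c} → c L.∈ trees E → proj₁ c ⊆ C
    E⊆C c∈ = p-x⊆p C r ∘ component-⊆ (E-comp c∈)

    r∉E : ∀ {c} → c L.∈ trees E → r ∉ proj₁ c
    r∉E c∈ = x∉p-x C r ∘ component-⊆ (E-comp c∈)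

    R∩C : ∀ {c} → c L.∈ trees R → v ∈ proj₁ c → v ∉ C
    R∩C c∈ v∈c = x∈p─q⇒x∉q (S - r₀) C (component-⊆ (All.lookup (comps R) c∈) v∈c)

    r₀∈M : r₀ ∈ M
    r₀∈M = ∈-M (x∈p∧x≢y⇒x∈p-y r₀∈S r₀≢r) (λ c∈ → r₀∉C ∘ E⊆C (upper⊆E c∈))

    lower⊆M : ∀ {c} → c L.∈ lower → proj₁ c ⊆ M
    lower⊆M c∈ v∈c = ∈-M
      (x∈p∧x≢y⇒x∈p-y (C⊆S (E⊆C (lower⊆E c∈) v∈c)) (λ { refl → r∉E (lower⊆E c∈) v∈c }))
      -- A vertex shared with a child in `upper` would make the two children have the same vertex
      -- set, but one touches `r₀` and the other does not.
      λ d∈ v∈d → proj₂ (∈-filter⁻ (¬? ∘ touches?) {xs = trees E} d∈)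
        (subst Touches (component-unique (E-comp (lower⊆E c∈)) (E-comp (upper⊆E d∈)) v∈c v∈d)
          (proj₂ (∈-filter⁻ touches? {xs = trees E} c∈)))

    R⊆M : ∀ {c} → c L.∈ trees R → proj₁ c ⊆ M
    R⊆M c∈ v∈c = ∈-M
      (x∈p∧x≢y⇒x∈p-y (p-x⊆p S r₀ (component-⊆ (R-comp c∈) v∈c)) (λ { refl → R∩C c∈ v∈c r∈C }))
      (λ d∈ v∈d → R∩C c∈ v∈c (E⊆C (upper⊆E d∈) v∈d))

    -- Closedness is used twice: `C` absorbs the neighbour within `S - r₀`, then the child of `r`
    -- absorbs it within `C - r`.
    E-closed : ∀ {c} → c L.∈ trees E → u ∈ proj₁ c → v ∈ S - r₀ → v ≢ r → v ∉ proj₁ c → ¬ Adjacent G u v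
    E-closed {u} {v} c∈ u∈c v∈ v≢r v∉c a =
      v∉c (component-closed (E-comp c∈) u∈c
        (x∈p∧x≢y⇒x∈p-y (component-closed C-comp (E⊆C c∈ u∈c) v∈ a) v≢r) a)

    M-r₀⊆S-r₀ : M - r₀ ⊆ S - r₀
    M-r₀⊆S-r₀ h = x∈p∧x≢y⇒x∈p-y (M⊆S (p-x⊆p M r₀ h)) (x∈p-y⇒x≢y M h)

    ∈-M-r₀ : v ∈ S - r₀ → v ∈ M → v ∈ M - r₀
    ∈-M-r₀ h v∈M = x∈p∧x≢y⇒x∈p-y v∈M (x∈p-y⇒x≢y S h)

    moved : Forest (M - r₀)
    moved = forest (lower ++ trees R)
      (All.++⁺ (All.tabulate lower-comp) (All.tabulate rest-comp))
      (AllPairs.++⁺ (AllPairs.filter⁺ touches? (disj E)) (disj R)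
        (All.tabulate λ c∈ → All.tabulate λ d∈ v v∈c v∈d → R∩C d∈ v∈d (E⊆C (lower⊆E c∈) v∈c)))
      moved-cover
      where
      lower-comp : ∀ {c} → c L.∈ lower → IsComponent G (M - r₀) (proj₁ c)
      lower-comp c∈ with lower⊆E c∈
      ... | c∈E with E-comp c∈E
      ...   | ne , _ , conn , _ =
        ne , (λ v∈c → ∈-M-r₀ (C⊆S-r₀ (E⊆C c∈E v∈c)) (lower⊆M c∈ v∈c)) , conn ,
        λ u v u∈c v∈ → E-closed c∈E u∈c (M-r₀⊆S-r₀ v∈) (x∈p-y⇒x≢y S (M⊆S-r (p-x⊆p M r₀ v∈)))
      rest-comp : ∀ {c} → c L.∈ trees R → IsComponent G (M - r₀) (proj₁ c)
      rest-comp c∈ with R-comp c∈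
      ... | ne , c⊆ , conn , closed =
        ne , (λ v∈c → ∈-M-r₀ (c⊆ v∈c) (R⊆M c∈ v∈c)) , conn , λ u v u∈c v∈ → closed u v u∈c (M-r₀⊆S-r₀ v∈)
      moved-cover : ∀ v → v ∈ M - r₀ → Any (λ c → v ∈ proj₁ c) (lower ++ trees R)
      moved-cover v v∈ with findTree before (M-r₀⊆S-r₀ v∈)
      ... | c , there c∈ , _ , v∈c = L.lose (∈-++⁺ʳ lower c∈) v∈c
      ... | _ , here refl , _ , v∈C
        with findTree E (x∈p∧x≢y⇒x∈p-y v∈C (x∈p-y⇒x≢y S (M⊆S-r (p-x⊆p M r₀ v∈))))
      ...   | c , c∈ , _ , v∈c with touches? c
      ...     | yes t = L.lose (∈-++⁺ˡ (∈-filter⁺ touches? c∈ t)) v∈c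
      ...     | no ¬t = contradiction v∈c (M∩upper (p-x⊆p M r₀ v∈) (∈-filter⁺ (¬? ∘ touches?) c∈ ¬t))

    attach : ∀ {X} → X ⊆ M → ConnectedIn G X → Touches X → u ∈ X → PathIn G M u r₀
    attach X⊆M conn (w , w∈X , a) u∈X =
      path-trans (path-mono X⊆M (conn _ w u∈X w∈X)) (step (X⊆M w∈X) a (stop r₀∈M))

    moved⊆M : ∀ {c} → c L.∈ trees moved → proj₁ c ⊆ M
    moved⊆M c∈ = p-x⊆p M r₀ ∘ component-⊆ (All.lookup (comps moved) c∈)

    -- Trees from `lower` touch `r₀` by selection, those from `R` because `S` is connected.
    moved-touches : ∀ {c} → c L.∈ trees moved → Touches (proj₁ c)
    moved-touches c∈ with ∈-++⁻ lower c∈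
    ... | inj₁ c∈lower = proj₂ (∈-filter⁻ touches? {xs = trees E} c∈lower)
    ... | inj₂ c∈R = component-touches S-conn r₀∈S (R-comp c∈R)

    path-to-r₀ : u ∈ M → PathIn G M u r₀
    path-to-r₀ {u} u∈M with u Fin.≟ r₀
    ... | yes refl = stop u∈M
    ... | no u≢r₀ with findTree moved (x∈p∧x≢y⇒x∈p-y u∈M u≢r₀)
    ...   | c , c∈ , (_ , _ , conn , _) , u∈c = attach (moved⊆M c∈) conn (moved-touches c∈) u∈c

    -- Of the possible neighbours in `S - r`, the vertex `r₀` is excluded by the choice of `upper`
    -- and all others by `E-closed`.
    upper-comp : ∀ {c} → c L.∈ upper → IsComponent G (S - r) (proj₁ c)
    upper-comp {c} c∈ with upper⊆E c∈
    ... | c∈E with E-comp c∈E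
    ...   | ne , _ , conn , _ =
      ne , (λ v∈c → x∈p∧x≢y⇒x∈p-y (C⊆S (E⊆C c∈E v∈c)) (λ { refl → r∉E c∈E v∈c })) , conn , closed
      where
      closed : ∀ u v → u ∈ proj₁ c → v ∈ S - r → v ∉ proj₁ c → ¬ Adjacent G u v
      closed u v u∈c v∈ v∉c a with v Fin.≟ r₀
      ... | yes refl = proj₂ (∈-filter⁻ (¬? ∘ touches?) {xs = trees E} c∈) (u , u∈c , a)
      ... | no v≢r₀ = E-closed c∈E u∈c (x∈p∧x≢y⇒x∈p-y (p-x⊆p S r v∈) v≢r₀) (x∈p-y⇒x≢y S v∈) v∉c a

    ∉M⇒∈upper : v ∈ S - r → v ∉ M → ∃ λ c → c L.∈ upper × v ∈ proj₁ c
    ∉M⇒∈upper v∈ v∉M with ∈-⋃⁻ (map proj₁ upper) (x∈p∧x∉p─q⇒x∈q (S - r) _ v∈ v∉M)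
    ... | p , p∈ , v∈p with ∈-map⁻ proj₁ p∈
    ...   | c , c∈ , refl = c , c∈ , v∈p

    -- Any two vertices are joined through `r₀`. An edge leaving `M` would end in a component from
    -- `upper`, which would then absorb its start.
    M-comp : IsComponent G (S - r) M
    M-comp = (r₀ , r₀∈M) , M⊆S-r ,
      (λ u v u∈M v∈M → path-trans (path-to-r₀ u∈M) (path-sym (path-to-r₀ v∈M))) , closed
      where
      closed : ∀ u v → u ∈ M → v ∈ S - r → v ∉ M → ¬ Adjacent G u v
      closed u v u∈M v∈ v∉M a with ∉M⇒∈upper v∈ v∉M
      ... | c , c∈ , v∈c = M∩upper u∈M c∈ (component-closed (upper-comp c∈) v∈c (M⊆S-r u∈M) (adjacent-sym a))

    after : Forest (S - r)
    after = forest ((M , graft r₀ r₀∈M moved) ∷ upper)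
      (M-comp ∷ All.tabulate upper-comp)
      (All.tabulate (λ c∈ v v∈M → M∩upper v∈M c∈) ∷ AllPairs.filter⁺ (¬? ∘ touches?) (disj E))
      after-cover
      where
      after-cover : ∀ v → v ∈ S - r → Any (λ c → v ∈ proj₁ c) ((M , graft r₀ r₀∈M moved) ∷ upper)
      after-cover v v∈ with v ∈? M
      ... | yes v∈M = here v∈M
      ... | no v∉M with ∉M⇒∈upper v∈ v∉M
      ...   | c , c∈ , v∈c = there (L.lose c∈ v∈c)

    tubes₀ tubes₁ : List (Subset n)
    tubes₀ = treeTubes (graft r₀ r₀∈S before)
    tubes₁ = treeTubes (graft r r∈S after)

    -- `C` contains `r` but not `r₀`, and `S` is the only tube of the new tree that contains `r`.
    -- The next lemma is the mirror image.
    C∉tubes₁ : ¬ C L.∈ tubes₁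
    C∉tubes₁ (here C≡S) = r₀∉C (subst (r₀ ∈_) (≡-sym C≡S) r₀∈S)
    C∉tubes₁ (there h) = x∉p-x S r (forest-tube-⊆ after h r∈C)

    M∉tubes₀ : ¬ M L.∈ tubes₀
    M∉tubes₀ (here M≡S) = x∉p-x S r (M⊆S-r (subst (r ∈_) (≡-sym M≡S) r∈S))
    M∉tubes₀ (there h) = x∉p-x S r₀ (forest-tube-⊆ before h r₀∈M)

    C∈tubes₀ : C L.∈ tubes₀
    C∈tubes₀ = there (here refl)

    M∈tubes₁ : M L.∈ tubes₁
    M∈tubes₁ = there (here refl)

    E-tubes⁺ : ∀ {X} → X L.∈ forestTubes E → X L.∈ tubes₁
    E-tubes⁺ h with ∈-tubesList⁻ (trees E) h
    ... | c , c∈ , h′ with touches? c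
    ...   | yes t = there (there (∈-++⁺ˡ (∈-tubesList⁺ {cs = trees moved} (∈-++⁺ˡ (∈-filter⁺ touches? c∈ t)) h′)))
    ...   | no ¬t = there (∈-tubesList⁺ {cs = trees after} (there (∈-filter⁺ (¬? ∘ touches?) c∈ ¬t)) h′)

    R-tubes⁺ : ∀ {X} → X L.∈ forestTubes R → X L.∈ tubes₁
    R-tubes⁺ h with ∈-tubesList⁻ (trees R) h
    ... | c , c∈ , h′ = there (there (∈-++⁺ˡ (∈-tubesList⁺ {cs = trees moved} (∈-++⁺ʳ lower c∈) h′)))

    E-tubes⁻ : ∀ {X c} → c L.∈ trees E → X L.∈ treeTubes (proj₂ c) → X L.∈ tubes₀
    E-tubes⁻ c∈ h = there (there (∈-++⁺ˡ (∈-tubesList⁺ c∈ h)))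

    tubes₀⊆ : ∀ {X} → X L.∈ tubes₀ → X L.∈ tubes₁ ⊎ X ≡ C
    tubes₀⊆ (here X≡S) = inj₁ (here X≡S)
    tubes₀⊆ (there (here X≡C)) = inj₂ X≡C
    tubes₀⊆ (there (there h)) = inj₁ ([ E-tubes⁺ , R-tubes⁺ ]′ (∈-++⁻ (forestTubes E) h))

    tubes₁⊆ : ∀ {X} → X L.∈ tubes₁ → X L.∈ tubes₀ ⊎ X ≡ M
    tubes₁⊆ (here X≡S) = inj₁ (here X≡S)
    tubes₁⊆ (there (here X≡M)) = inj₂ X≡M
    tubes₁⊆ (there (there h)) with ∈-++⁻ (forestTubes moved) h
    ... | inj₂ h′ with ∈-tubesList⁻ upper h′
    ...   | c , c∈ , h″ = inj₁ (E-tubes⁻ (upper⊆E c∈) h″)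
    tubes₁⊆ (there (there h)) | inj₁ h′ with ∈-tubesList⁻ (trees moved) h′
    ... | c , c∈ , h″ with ∈-++⁻ lower c∈
    ...   | inj₁ c∈lower = inj₁ (E-tubes⁻ (lower⊆E c∈lower) h″)
    ...   | inj₂ c∈R = inj₁ (there (there (∈-++⁺ʳ (forestTubes E) (∈-tubesList⁺ c∈R h″))))

    rotation : Flip tubes₀ tubes₁
    rotation = C , M , (λ C≡M → r₀∉C (subst (r₀ ∈_) (≡-sym C≡M) r₀∈M)) ,
      inj₁ (C∈tubes₀ , C∉tubes₁) , inj₂ (M∈tubes₁ , M∉tubes₀) , λ where
        Z (inj₁ (h , ¬h)) → inj₁ ([ ⊥-elim ∘ ¬h , id ]′ (tubes₀⊆ h))
        Z (inj₂ (h , ¬h)) → inj₂ ([ ⊥-elim ∘ ¬h , id ]′ (tubes₁⊆ h))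

  -- Upper bound on the diameter.

  raise-root : (t : Tree S) → ConnectedIn G S → ∀ r → (r∈S : r ∈ S) →
    Σ (Forest (S - r)) λ F → ∃ λ k → k ≤ ∣ S ∣ × Walk treeTubes t (graft r r∈S F) k
  raise-root = tree-ind Raisable ind
    where
    Raisable : ∀ {S} → Tree S → Set
    Raisable {S} t = ConnectedIn G S → ∀ r → (r∈S : r ∈ S) →
      Σ (Forest (S - r)) λ F → ∃ λ k → k ≤ ∣ S ∣ × Walk treeTubes t (graft r r∈S F) k

    ind : ∀ {S} r₀ (r₀∈S : r₀ ∈ S) (F : Forest (S - r₀)) →
      All (λ c → Raisable (proj₂ c)) (trees F) → Raisable (graft r₀ r₀∈S F)
    ind {S} r₀ r₀∈S F ih S-conn r r∈S with r Fin.≟ r₀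
    ... | yes refl = F , 0 , z≤n , same ≋-refl
    ... | no r≢r₀ with findTree F (x∈p∧x≢y⇒x∈p-y r∈S r≢r₀)
    -- First `r` is raised to the root of the child `C` that contains it; one more rotation takes it
    -- past `r₀`.
    ...   | (C , t) , c∈ , (_ , _ , C-conn , _) , r∈C with extract F c∈ | All.lookup ih c∈ C-conn r r∈C
    ...     | C-comp , R , F≋ | E , k , k≤ , w = after , suc k , bound ,
                step (walk-≋ˡ (≋-∷ F≋) (graft-walk r₀∈S (cons-walkˡ C-comp R w))) rotation
      where
      open Rotate S-conn r₀∈S C-comp r∈C E R
      -- `C` misses `r₀`, so the drop from `∣ S ∣` to `∣ C ∣` pays for the last rotation.
      bound : suc k ≤ ∣ S ∣
      bound = ≤-trans (s≤s (≤-trans k≤ (p⊆q⇒∣p∣≤∣q∣ C⊆S-r₀))) (x∈p⇒∣p-x∣<∣p∣ r₀∈S)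

  -- The product with the height stands in for the sum of the tube sizes; in this form the bound
  -- passes both through a forest and past a root.
  WithinHeight : Tree S → Set
  WithinHeight {S} t* = ConnectedIn G S → (t : Tree S) →
    ∃ λ k → k ≤ ∣ S ∣ * height G t* × Walk treeTubes t t* k

  -- Both forests have the components of `S` as vertex sets. The first component `D` of the target
  -- is also that of a child of `F`, which is turned into `d` by itself; the rest is a forest on
  -- `S ─ D`.
  forest-walk : (ds : List Child) → All (λ d → WithinHeight (proj₂ d)) ds →
    (F* : Forest S) → trees F* ≡ ds → (F : Forest S) →
    ∃ λ k → k ≤ ∣ S ∣ * heightList G ds × Walk forestTubes F F* k
  -- An empty `F*` covers no vertex, so `S` is empty and `F` has no tube, tubes being nonempty.
  forest-walk [] _ F* refl F = 0 , z≤n , same ((λ X → ⊥-elim ∘ no-tube) , λ _ ())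
    where
    no-tube : ∀ {X} → ¬ X L.∈ forestTubes F
    no-tube h with ∈-tubesList⁻ (trees F) h
    ... | (_ , t) , _ , h′ with tube-nonempty t h′
    ...   | v , v∈X with findTree F* (forest-tube-⊆ F h v∈X)
    ...     | _ , () , _
  forest-walk {S} ((D , d) ∷ ds) (ih ∷ ihs) F* refl F with uncons F* refl
  ... | D-comp@((v , v∈D) , D⊆S , D-conn , _) , F*′ , refl with findTree F (D⊆S v∈D)
  ...   | (C , t) , c∈ , C-comp , v∈C with component-unique C-comp D-comp v∈C v∈D
  ...     | refl with extract F c∈
  ...       | comp , R , F≋ with ih D-conn t | forest-walk ds ihs F*′ refl R
  ...         | j , j≤ , w | k , k≤ , w′ = k + j , bound ,
    -- `cons comp d F*′` and `F*` may carry different proofs, but their lists of tubes coincide,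
    -- hence `≋-refl`.
    walk-≋ˡ F≋ (walk-≋ʳ (walk-trans (cons-walkˡ comp R w) (cons-walkʳ comp d w′)) ≋-refl)
    where
    open ≤-Reasoning
    h h′ : ℕ
    h = height G d
    h′ = heightList G ds
    bound : k + j ≤ ∣ S ∣ * (h ⊔ h′)
    bound = begin
      k + j                                             ≤⟨ +-mono-≤ k≤ j≤ ⟩
      ∣ S ─ D ∣ * h′ + ∣ D ∣ * h                        ≤⟨ +-mono-≤ (*-monoʳ-≤ ∣ S ─ D ∣ (m≤n⊔m h h′))
                                                                    (*-monoʳ-≤ ∣ D ∣ (m≤m⊔n h h′)) ⟩
      ∣ S ─ D ∣ * (h ⊔ h′) + ∣ D ∣ * (h ⊔ h′)           ≡⟨ *-distribʳ-+ (h ⊔ h′) ∣ S ─ D ∣ ∣ D ∣ ⟨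
      (∣ S ─ D ∣ + ∣ D ∣) * (h ⊔ h′)                    ≡⟨ cong (_* (h ⊔ h′)) (+-comm ∣ S ─ D ∣ ∣ D ∣) ⟩
      (∣ D ∣ + ∣ S ─ D ∣) * (h ⊔ h′)                    ≤⟨ *-monoˡ-≤ (h ⊔ h′) (∣q∣+∣p─q∣≤∣p∣ S D D⊆S) ⟩
      ∣ S ∣ * (h ⊔ h′)                                  ∎

  tree-walk : (t* : Tree S) → WithinHeight t*
  tree-walk = tree-ind WithinHeight ind
    where
    ind : ∀ {S} r (r∈S : r ∈ S) (F : Forest (S - r)) →
      All (λ c → WithinHeight (proj₂ c)) (trees F) → WithinHeight (graft r r∈S F)
    ind {S} r r∈S F ih S-conn t with raise-root t S-conn r r∈S
    ... | F₀ , j , j≤ , w with forest-walk (trees F) ih F refl F₀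
    ...   | k , k≤ , w′ = k + j , bound , walk-trans w (graft-walk r∈S w′)
      where
      open ≤-Reasoning
      h : ℕ
      h = heightList G (trees F)
      bound : k + j ≤ ∣ S ∣ * suc h
      bound = begin
        k + j                 ≤⟨ +-mono-≤ k≤ j≤ ⟩
        ∣ S - r ∣ * h + ∣ S ∣ ≤⟨ +-monoˡ-≤ ∣ S ∣ (*-monoˡ-≤ h (p⊆q⇒∣p∣≤∣q∣ (p-x⊆p S r))) ⟩
        ∣ S ∣ * h + ∣ S ∣     ≡⟨ +-comm (∣ S ∣ * h) ∣ S ∣ ⟩
        ∣ S ∣ + ∣ S ∣ * h     ≡⟨ *-suc ∣ S ∣ h ⟨
        ∣ S ∣ * suc h         ∎

  reach : ∀ {T T′ : ST G} {k} → Walk (tubes G) T T′ k → Reach G T T′ k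
  reach (same e) = same e
  reach (step w r) = step (reach w) r

  diameter-upper-bound : ∀ {t} → Connected G → TreeDepthAtMost G t → DiamAtMost G (2 * t * n)
  diameter-upper-bound {t} conn (T* , h≤t) T T′ with tree-walk T* conn T | tree-walk T* conn T′
  ... | j , j≤ , w | k , k≤ , w′ = k + j , bound , reach (walk-trans w (walk-sym w′))
    where
    open ≤-Reasoning
    H : ℕ
    H = height G T*
    bound : k + j ≤ 2 * t * n
    bound = begin
      k + j                                   ≤⟨ +-mono-≤ k≤ j≤ ⟩
      ∣ ⊤ {n} ∣ * H + ∣ ⊤ {n} ∣ * H           ≡⟨ cong (λ m → m * H + m * H) (∣⊤∣≡n n) ⟩
      n * H + n * H                           ≤⟨ +-mono-≤ (*-monoʳ-≤ n h≤t) (*-monoʳ-≤ n h≤t) ⟩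
      n * t + n * t                           ≡⟨ *-distribˡ-+ n t t ⟨
      n * (t + t)                             ≡⟨ *-comm n (t + t) ⟩
      (t + t) * n                             ≡⟨ cong (λ m → (t + m) * n) (+-identityʳ t) ⟨
      2 * t * n                               ∎

  -- Edges reversed by rotations

  forest-tree-unique : ∀ (F : Forest S) {c d} → c L.∈ trees F → d L.∈ trees F →
    v ∈ proj₁ c → v ∈ proj₁ d → c ≡ d
  forest-tree-unique {v = v} F = go (disj F)
    where
    go : ∀ {cs c d} → AllPairs (λ c d → Disjoint G (proj₁ c) (proj₁ d)) cs →
      c L.∈ cs → d L.∈ cs → v ∈ proj₁ c → v ∈ proj₁ d → c ≡ d
    go _ (here refl) (here refl) _ _ = refl
    go (p ∷ _) (here refl) (there d∈) v∈c v∈d = contradiction v∈d (All.lookup p d∈ v v∈c)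
    go (p ∷ _) (there c∈) (here refl) v∈c v∈d = contradiction v∈c (All.lookup p c∈ v v∈d)
    go (_ ∷ ps) (there c∈) (there d∈) v∈c v∈d = go ps c∈ d∈ v∈c v∈d

  -- Tubes below different children lie in different components, which share no vertex and are
  -- joined by no edge. Below the same child the induction applies.
  tubes-nested : ∀ (t : Tree S) {X Y u v} → X L.∈ treeTubes t → Y L.∈ treeTubes t →
    u ∈ X → v ∈ Y → u ≡ v ⊎ Adjacent G u v → X ⊆ Y ⊎ Y ⊆ X
  tubes-nested = tree-ind Nested ind
    where
    Nested : ∀ {S} → Tree S → Set
    Nested t = ∀ {X Y u v} → X L.∈ treeTubes t → Y L.∈ treeTubes t →
      u ∈ X → v ∈ Y → u ≡ v ⊎ Adjacent G u v → X ⊆ Y ⊎ Y ⊆ X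
    ind : ∀ {S} r (r∈S : r ∈ S) (F : Forest (S - r)) →
      All (λ c → Nested (proj₂ c)) (trees F) → Nested (graft r r∈S F)
    ind r r∈S F ih (here refl) h _ _ _ = inj₂ (tube-⊆ (graft r r∈S F) h)
    ind r r∈S F ih (there h) (here refl) _ _ _ = inj₁ (tube-⊆ (graft r r∈S F) (there h))
    ind {S} r r∈S F ih {u = u} {v} (there h) (there h′) u∈X v∈Y uv
      with ∈-tubesList⁻ (trees F) h | ∈-tubesList⁻ (trees F) h′
    ... | (C , t) , c∈ , X∈t | (D , t′) , d∈ , Y∈t′ = meet (forest-tree-unique F c∈ d∈ v∈C v∈D)
      where
      v∈D : v ∈ D
      v∈D = tube-⊆ t′ Y∈t′ v∈Y
      v∈C : v ∈ C
      v∈C = [ (λ u≡v → subst (_∈ C) u≡v (tube-⊆ t X∈t u∈X))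
            , component-closed (All.lookup (comps F) c∈) (tube-⊆ t X∈t u∈X)
                (component-⊆ (All.lookup (comps F) d∈) v∈D) ]′ uv
      meet : (C , t) ≡ (D , t′) → _
      meet refl = All.lookup ih c∈ X∈t Y∈t′ u∈X v∈Y uv

  -- Descend into the child containing `u` as long as it also contains `v`. The descent ends where
  -- `u` is the root, and the child of `v` separates, or where the child of `u` misses `v`.
  tubes-separate : ∀ (t : Tree S) → u ∈ S → v ∈ S → u ≢ v →
    ∃ λ X → X L.∈ treeTubes t × (u ∈ X × v ∉ X ⊎ v ∈ X × u ∉ X)
  tubes-separate {u = u} {v} =
    tree-ind (λ {S} t → u ∈ S → v ∈ S → u ≢ v →
      ∃ λ X → X L.∈ treeTubes t × (u ∈ X × v ∉ X ⊎ v ∈ X × u ∉ X)) ind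
    where
    ind : ∀ {S} r (r∈S : r ∈ S) (F : Forest (S - r)) →
      All (λ c → u ∈ proj₁ c → v ∈ proj₁ c → u ≢ v →
        ∃ λ X → X L.∈ treeTubes (proj₂ c) × (u ∈ X × v ∉ X ⊎ v ∈ X × u ∉ X)) (trees F) →
      u ∈ S → v ∈ S → u ≢ v →
      ∃ λ X → X L.∈ treeTubes (graft r r∈S F) × (u ∈ X × v ∉ X ⊎ v ∈ X × u ∉ X)
    ind {S} r r∈S F ih u∈S v∈S u≢v with u Fin.≟ r
    ... | yes refl with findTree F (x∈p∧x≢y⇒x∈p-y v∈S (u≢v ∘ ≡-sym))
    ...   | (C , t) , c∈ , C-comp , v∈C =
      C , there (∈-tubesList⁺ c∈ (S∈tubes t)) , inj₂ (v∈C , x∉p-x S r ∘ component-⊆ C-comp)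
    ind {S} r r∈S F ih u∈S v∈S u≢v | no u≢r with findTree F (x∈p∧x≢y⇒x∈p-y u∈S u≢r)
    ... | (C , t) , c∈ , C-comp , u∈C with v ∈? C
    ...   | no v∉C = C , there (∈-tubesList⁺ c∈ (S∈tubes t)) , inj₁ (u∈C , v∉C)
    ...   | yes v∈C with All.lookup ih c∈ u∈C v∈C u≢v
    ...     | X , X∈ , sep = X , there (∈-tubesList⁺ c∈ X∈) , sep

  -- For adjacent vertices of the tree this is the ancestor order; for incomparable vertices it
  -- holds both ways. Phrased by tubes, it can change only when a tube is lost or gained.
  Above : Tree S → Fin n → Fin n → Set
  Above t u v = ∃ λ X → X L.∈ treeTubes t × v ∈ X × u ∉ X

  -- The edge makes the two witnessing tubes nested, and the larger one then contains the vertex it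
  -- has to miss.
  above-asym : (t : Tree S) → Adjacent G u v → Above t u v → ¬ Above t v u
  above-asym t a (X , X∈ , v∈X , u∉X) (Y , Y∈ , u∈Y , v∉Y)
    with tubes-nested t Y∈ X∈ u∈Y v∈X (inj₂ a)
  ... | inj₁ Y⊆X = u∉X (Y⊆X u∈Y)
  ... | inj₂ X⊆Y = v∉Y (X⊆Y v∈X)

  above-total : (T : ST G) → u ≢ v → Above T u v ⊎ Above T v u
  above-total T u≢v with tubes-separate T ∈⊤ ∈⊤ u≢v
  ... | X , X∈ , inj₁ (u∈X , v∉X) = inj₂ (X , X∈ , u∈X , v∉X)
  ... | X , X∈ , inj₂ (v∈X , u∉X) = inj₁ (X , X∈ , v∈X , u∉X)

  adjacent-≢ : Adjacent G u v → u ≢ v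
  adjacent-≢ {u} a refl with trans (≡-sym a) (irrefl G u)
  ... | ()

  module _ (T T′ : ST G) (ρ : Rotation G T T′) {X Y : Subset n}
           (X-lost : tubes G T ∖ tubes G T′ ∋ X) (Y-gained : tubes G T′ ∖ tubes G T ∋ Y) where

    -- A tube W of T′ separating v from v′ is not Y, so it is a tube of T; it then lies inside X,
    -- hence misses u, and the tubes W and Y of T′ order u and v both ways.
    exchange-inseparable : ∀ {W v′} → Adjacent G u v → u ∈ Y → u ∉ X → v ∈ X → v ∉ Y → v′ ∈ X →
      W L.∈ tubes G T′ → v ∈ W → ¬ v′ ∉ W
    exchange-inseparable {W = W} uv u∈Y u∉X v∈X v∉Y v′∈X W∈T′ v∈W v′∉W = W∈T W∉T
      where
      W∈T : ¬ ¬ W L.∈ tubes G T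
      W∈T W∉T with lost-unique (Flip-sym ρ) Y-gained (W∈T′ , W∉T) X-lost
      ... | refl = v∉Y v∈W
      W∉T : ¬ W L.∈ tubes G T
      W∉T W∈T with tubes-nested T W∈T (proj₁ X-lost) v∈W v∈X (inj₁ refl)
      ... | inj₁ W⊆X = above-asym T′ uv (W , W∈T′ , v∈W , u∉X ∘ W⊆X) (Y , proj₁ Y-gained , u∈Y , v∉Y)
      ... | inj₂ X⊆W = v′∉W (X⊆W v′∈X)

    exchange-unique : ∀ {v′} → Adjacent G u v → Adjacent G u v′ → u ∈ Y → u ∉ X →
      v ∈ X → v ∉ Y → v′ ∈ X → v′ ∉ Y → v ≡ v′
    exchange-unique {v = v} {v′ = v′} uv uv′ u∈Y u∉X v∈X v∉Y v′∈X v′∉Y with v Fin.≟ v′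
    ... | yes v≡v′ = v≡v′
    ... | no v≢v′ with tubes-separate T′ ∈⊤ ∈⊤ v≢v′
    ...   | W , W∈T′ , inj₁ (v∈W , v′∉W) =
      ⊥-elim (exchange-inseparable uv u∈Y u∉X v∈X v∉Y v′∈X W∈T′ v∈W v′∉W)
    ...   | W , W∈T′ , inj₂ (v′∈W , v∉W) =
      ⊥-elim (exchange-inseparable uv′ u∈Y u∉X v′∈X v′∉Y v∈X W∈T′ v′∈W v∉W)

  Reversed : ST G → ST G → Fin n → Fin n → Set
  Reversed T T′ u v = Above T u v × Above T′ v u

  -- A tube witnessing the old order cannot survive in `T′`: with the new order it would contradict
  -- `above-asym`.
  reversed-lost : ∀ (T T′ : ST G) → Adjacent G u v → Reversed T T′ u v →
    ∃ λ X → tubes G T ∖ tubes G T′ ∋ X × v ∈ X × u ∉ X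
  reversed-lost T T′ a ((X , X∈ , v∈X , u∉X) , below) =
    X , (X∈ , λ X∈T′ → above-asym T′ a (X , X∈T′ , v∈X , u∉X) below) , v∈X , u∉X

  -- Both edges are reversed by the same lost tube and the same gained tube. Through the cross edge
  -- `u v′`, `exchange-unique` gives `v ≡ v′`; through `u′ v`, for the inverse rotation, it gives
  -- `u ≡ u′`.
  reversed-unique : ∀ (T T′ : ST G) {u v u′ v′} → Rotation G T T′ →
    Adjacent G u v → Adjacent G u′ v′ → Adjacent G u v′ → Adjacent G u′ v →
    Reversed T T′ u v → Reversed T T′ u′ v′ → u ≡ u′ × v ≡ v′
  reversed-unique T T′ ρ uv u′v′ uv′ u′v rev rev′
    with reversed-lost T T′ uv rev | reversed-lost T T′ u′v′ rev′
       | reversed-lost T′ T (adjacent-sym uv) (Product.swap rev) | reversed-lost T′ T (adjacent-sym u′v′) (Product.swap rev′)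
  ... | X , lost , v∈X , u∉X | X′ , lost′ , v′∈X′ , u′∉X′
      | Y , gained , u∈Y , v∉Y | Y′ , gained′ , u′∈Y′ , v′∉Y′
    with lost-unique ρ lost lost′ gained | lost-unique (Flip-sym ρ) gained gained′ lost
  ... | refl | refl =
    exchange-unique T′ T (Flip-sym ρ) gained lost (adjacent-sym uv) (adjacent-sym u′v) v∈X v∉Y u∈Y u∉X u′∈Y′ u′∉X′ ,
    exchange-unique T T′ ρ lost gained uv uv′ u∈Y u∉X v∈X v∉Y v′∈X′ v′∉Y′

  -- Counting reversals along a sequence of rotations.

  ReversedAt : ∀ {T T′ k} → Reach G T T′ k → Fin k → Fin n → Fin n → Set
  -- Positions count from the end: `zero` is the last rotation.
  ReversedAt (step {T' = T₁} {T'' = T₂} ρ _) zero u v = Reversed T₁ T₂ u v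
  ReversedAt (step ρ _) (suc j) u v = ReversedAt ρ j u v

  -- Look at the order just before the last rotation: either `u` is still above `v` and this
  -- rotation reverses the edge, or an earlier one did.
  reversal : ∀ {T T′ k} (ρ : Reach G T T′ k) → Adjacent G u v → Reversed T T′ u v →
    ∃ λ j → ReversedAt ρ j u v
  reversal {T′ = T′} (same (f , _)) a ((X , X∈ , h) , below) =
    contradiction below (above-asym T′ a (X , f X X∈ , h))
  reversal (step {T' = T₁} ρ _) a (above , below) with above-total T₁ (adjacent-≢ a)
  ... | inj₁ above₁ = zero , above₁ , below
  ... | inj₂ below₁ = let (j , h) = reversal ρ a (above , below₁) in suc j , h

  reversedAt-unique : ∀ {T T′ k u v u′ v′} (ρ : Reach G T T′ k) j →
    Adjacent G u v → Adjacent G u′ v′ → Adjacent G u v′ → Adjacent G u′ v →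
    ReversedAt ρ j u v → ReversedAt ρ j u′ v′ → u ≡ u′ × v ≡ v′
  reversedAt-unique (step {T' = T₁} {T'' = T₂} _ r) zero = reversed-unique T₁ T₂ r
  reversedAt-unique (step ρ _) (suc j) = reversedAt-unique ρ j

  -- Each of the `p * q` edges is sent to a rotation that reverses it; `reversedAt-unique` makes
  -- this map injective.
  biclique-bound : ∀ {p q} (a : Fin p → Fin n) (b : Fin q → Fin n) →
    (∀ {i i′} → a i ≡ a i′ → i ≡ i′) → (∀ {j j′} → b j ≡ b j′ → j ≡ j′) →
    (∀ i j → Adjacent G (a i) (b j)) →
    ∀ {T T′ k} → (∀ i j → Reversed T T′ (a i) (b j)) → Reach G T T′ k → p * q ≤ k
  biclique-bound {p} {q} a b a-inj b-inj ab rev ρ = Fin.injective⇒≤ {f = index} index-injective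
    where
    at : (e : Fin (p * q)) → ∃ λ j → ReversedAt ρ j (a (proj₁ (remQuot q e))) (b (proj₂ (remQuot {p} q e)))
    at e = reversal ρ (ab _ _) (rev _ _)
    index : Fin (p * q) → _
    index = proj₁ ∘ at
    index-injective : ∀ {e e′} → index e ≡ index e′ → e ≡ e′
    index-injective {e} {e′} eq
      with reversedAt-unique ρ (index e) (ab _ _) (ab _ _) (ab _ _) (ab _ _) (proj₂ (at e))
             (subst (λ j → ReversedAt ρ j _ _) (≡-sym eq) (proj₂ (at e′)))
    ... | eqᵃ , eqᵇ = trans (≡-sym (Fin.combine-remQuot {p} q e))
      (trans (cong₂ combine (a-inj eqᵃ) (b-inj eqᵇ)) (Fin.combine-remQuot {p} q e′))

-- Complete bipartite graphs

module Bipartite {n : ℕ} (side : Fin n → Bool) where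

  graph : Graph n
  graph = record
    { adj    = λ u v → side u xor side v
    ; sym    = λ u v → Bool.xor-comm (side u) (side v)
    ; irrefl = λ u → Bool.xor-same (side u)
    }

  On : Bool → Fin n → Set
  On b v = side v ≡ b

  across : ∀ b {u v} → On b u → On (not b) v → Adjacent graph u v
  across true  p q rewrite p | q = refl
  across false p q rewrite p | q = refl

  independent : ∀ {b u v} → On b u → On b v → ¬ Adjacent graph u v
  independent {b} p q rewrite p | q | Bool.xor-same b = λ ()

  sides : ∀ b v → On b v ⊎ On (not b) v
  sides b v with side v Bool.≟ b
  ... | yes p = inj₁ p
  ... | no p = inj₂ (Bool.¬-not p)

  -- Vertices on opposite sides are adjacent; two on the same side are joined through `x` or `y`,
  -- whichever is opposite.
  connected : ∀ b {S x y} → x ∈ S → On b x → y ∈ S → On (not b) y → ConnectedIn graph S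
  connected b {S} {x} {y} x∈ xb y∈ yb u v u∈ v∈ with sides b u | sides b v
  ... | inj₁ p | inj₂ q = step u∈ (across b p q) (stop v∈)
  ... | inj₂ p | inj₁ q = step u∈ (adjacent-sym graph {v} (across b q p)) (stop v∈)
  ... | inj₁ p | inj₁ q = step u∈ (across b p yb) (step y∈ (adjacent-sym graph {v} (across b q yb)) (stop v∈))
  ... | inj₂ p | inj₂ q = step u∈ (adjacent-sym graph {x} (across b xb p)) (step x∈ (across b xb q) (stop v∈))

  -- An enumeration without repetition; `chain` takes its roots from the list in order.
  record _Lists_ (l : List (Fin n)) (S : Subset n) : Set where
    constructor lists
    field
      unique : AllPairs _≢_ l
      sound  : ∀ {v} → v L.∈ l → v ∈ S
      total  : ∀ {v} → v ∈ S → v L.∈ l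

  open _Lists_

  tail-lists : ∀ {r l S} → (r ∷ l) Lists S → l Lists (S - r)
  tail-lists {r} {l} {S} (lists (r∉l ∷ u) s t) = lists u
    (λ v∈l → x∈p∧x≢y⇒x∈p-y (s (there v∈l)) (λ v≡r → All.lookup r∉l v∈l (≡-sym v≡r)))
    λ v∈ → drop (x∈p-y⇒x≢y S v∈) (t (p-x⊆p S r v∈))
    where
    drop : ∀ {v} → v ≢ r → v L.∈ r ∷ l → v L.∈ l
    drop v≢r (here v≡r) = contradiction v≡r v≢r
    drop _ (there v∈l) = v∈l

  leaf : (v : Fin n) → Child graph
  leaf v = ⁅ v ⁆ , node v (x∈⁅x⁆ v) [] [] []
    (λ w w∈ → contradiction (x∈⁅y⁆⇒x≡y v (p-x⊆p ⁅ v ⁆ v w∈)) (x∈p-y⇒x≢y ⁅ v ⁆ w∈))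

  -- One side of the graph is independent, so the components are the singletons.
  leaves : ∀ {b l S} → l Lists S → All (On b) l → Forest graph S
  leaves {b} {l} {S} ls on = forest (map leaf l)
    (All.map⁺ (All.tabulate leaf-comp))
    (AllPairs.map⁺ (AllPairs.map (λ {u} {v} u≢v w w∈u w∈v →
      u≢v (trans (≡-sym (x∈⁅y⁆⇒x≡y u w∈u)) (x∈⁅y⁆⇒x≡y v w∈v))) (unique ls)))
    (λ v v∈S → L.lose (∈-map⁺ leaf (total ls v∈S)) (x∈⁅x⁆ v))
    where
    leaf-comp : ∀ {v} → v L.∈ l → IsComponent graph S ⁅ v ⁆
    leaf-comp {v} v∈l = (v , x∈⁅x⁆ v) ,
      (λ u∈ → subst (_∈ S) (≡-sym (x∈⁅y⁆⇒x≡y v u∈)) (sound ls v∈l)) , conn , closed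
      where
      conn : ConnectedIn graph ⁅ v ⁆
      conn u w u∈ w∈ with x∈⁅y⁆⇒x≡y v u∈ | x∈⁅y⁆⇒x≡y v w∈
      ... | refl | refl = stop u∈
      closed : ∀ u w → u ∈ ⁅ v ⁆ → w ∈ S → w ∉ ⁅ v ⁆ → ¬ Adjacent graph u w
      closed u w u∈ w∈S _ with x∈⁅y⁆⇒x≡y v u∈
      ... | refl = independent (All.lookup on v∈l) (All.lookup on (total ls w∈S))

  leaves-height : ∀ l → heightList graph (map leaf l) ≤ 1
  leaves-height [] = z≤n
  leaves-height (v ∷ l) = ⊔-lub ≤-refl (leaves-height l)

  -- While a vertex of each side remains, `S - r` is connected and is the only child. Once the last
  -- `r` is removed, the other side falls apart into leaves; they add one level to the
  -- `1 + length rs` of the chain.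
  chain : ∀ b r rs x xs {S} → (r ∷ rs ++ x ∷ xs) Lists S → All (On b) (r ∷ rs) → All (On (not b)) (x ∷ xs) →
    Σ (Tree graph S) λ t → height graph t ≤ 2 + length rs ×
      (∀ {u v} → u L.∈ r ∷ rs → v L.∈ x ∷ xs → Above graph t u v)
  chain b r [] x xs {S} ls _ onˣ = graft graph r (sound ls (here refl)) star , s≤s (leaves-height (x ∷ xs)) , above
    where
    star : Forest graph (S - r)
    star = leaves (tail-lists ls) onˣ
    above : ∀ {u v} → u L.∈ r ∷ [] → v L.∈ x ∷ xs → Above graph (graft graph r (sound ls (here refl)) star) u v
    above {v = v} (here refl) v∈ = ⁅ v ⁆ , there (∈-tubesList⁺ graph (∈-map⁺ leaf v∈) (here refl)) ,
      x∈⁅x⁆ v , λ r∈ → x∈p-y⇒x≢y S (sound (tail-lists ls) v∈) (≡-sym (x∈⁅y⁆⇒x≡y v r∈))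
  chain b r (r′ ∷ rs) x xs {S} ls (_ ∷ onʳ) onˣ with chain b r′ rs x xs (tail-lists ls) onʳ onˣ
  ... | t , h≤ , above = graft graph r (sound ls (here refl)) F , s≤s (⊔-lub h≤ z≤n) , above′
    where
    ls′ : (r′ ∷ rs ++ x ∷ xs) Lists (S - r)
    ls′ = tail-lists ls
    F : Forest graph (S - r)
    F = forest ((S - r , t) ∷ [])
      (((r′ , sound ls′ (here refl)) , id ,
        connected b (sound ls′ (here refl)) (All.head onʳ) (sound ls′ (∈-++⁺ʳ (r′ ∷ rs) (here refl))) (All.head onˣ) ,
        (λ u v _ v∈ v∉ → contradiction v∈ v∉)) ∷ [])
      ([] ∷ []) (λ v → here)
    above′ : ∀ {u v} → u L.∈ r ∷ r′ ∷ rs → v L.∈ x ∷ xs → Above graph (graft graph r (sound ls (here refl)) F) u v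
    above′ (here refl) v∈ = S - r , there (∈-++⁺ˡ (S∈tubes graph t)) , sound ls′ (∈-++⁺ʳ (r′ ∷ rs) v∈) , x∉p-x S r
    above′ (there u∈) v∈ with above u∈ v∈
    ... | X , X∈ , sep = X , there (∈-++⁺ˡ X∈) , sep

-- The instance with sides of sizes `suc p` and `suc q`.

module CompleteBipartite (p q : ℕ) where

  left : Fin (suc p) → Fin (suc p + suc q)
  left i = i ↑ˡ suc q

  right : Fin (suc q) → Fin (suc p + suc q)
  right j = suc p ↑ʳ j

  side : Fin (suc p + suc q) → Bool
  side v = [ (λ _ → true) , (λ _ → false) ]′ (splitAt (suc p) v)

  open Bipartite side

  side-left : ∀ i → side (left i) ≡ true
  side-left i rewrite Fin.splitAt-↑ˡ (suc p) i (suc q) = refl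

  side-right : ∀ j → side (right j) ≡ false
  side-right j rewrite Fin.splitAt-↑ʳ (suc p) (suc q) j = refl

  lefts rights : List (Fin (suc p + suc q))
  lefts = tabulate left
  rights = tabulate right

  left∈ : ∀ i → left i L.∈ lefts
  left∈ i = ∈-tabulate⁺ {f = left} i

  right∈ : ∀ j → right j L.∈ rights
  right∈ j = ∈-tabulate⁺ {f = right} j

  ∈-lefts⊎rights : ∀ v → v L.∈ lefts ⊎ v L.∈ rights
  ∈-lefts⊎rights v with splitAt (suc p) v in eq
  ... | inj₁ i = inj₁ (subst (L._∈ lefts) (Fin.splitAt⁻¹-↑ˡ eq) (left∈ i))
  ... | inj₂ j = inj₂ (subst (L._∈ rights) (Fin.splitAt⁻¹-↑ʳ eq) (right∈ j))

  on-left : All (On true) lefts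
  on-left = All.tabulate⁺ {f = left} side-left

  on-right : All (On false) rights
  on-right = All.tabulate⁺ {f = right} side-right

  all-lists : ∀ {b l m} → AllPairs _≢_ l → AllPairs _≢_ m → All (On b) l → All (On (not b)) m →
    (∀ v → v L.∈ l ⊎ v L.∈ m) → (l ++ m) Lists ⊤
  all-lists {b} {l} ul um on on′ cov = lists
    (AllPairs.++⁺ ul um (All.map (λ u-on → All.map (λ v-on → λ { refl → Bool.not-¬ u-on v-on }) on′) on))
    (λ _ → ∈⊤) (λ {v} _ → [ ∈-++⁺ˡ , ∈-++⁺ʳ l ]′ (cov v))

  left-injective : ∀ {i i′} → left i ≡ left i′ → i ≡ i′
  left-injective = Fin.↑ˡ-injective (suc q) _ _

  right-injective : ∀ {j j′} → right j ≡ right j′ → j ≡ j′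
  right-injective = Fin.↑ʳ-injective (suc p) _ _

  lefts-unique : AllPairs _≢_ lefts
  lefts-unique = AllPairs.tabulate⁺ {f = left} (λ i≢j → i≢j ∘ left-injective)

  rights-unique : AllPairs _≢_ rights
  rights-unique = AllPairs.tabulate⁺ {f = right} (λ i≢j → i≢j ∘ right-injective)

  graph-connected : Connected graph
  graph-connected = connected true {x = left zero} {right zero} ∈⊤ (side-left zero) ∈⊤ (side-right zero)

  left-first : Σ (ST graph) λ T → height graph T ≤ 2 + length (tabulate (left ∘ suc)) ×
    (∀ {u v} → u L.∈ lefts → v L.∈ rights → Above graph T u v)
  left-first = chain true _ _ _ _
    (all-lists lefts-unique rights-unique on-left on-right ∈-lefts⊎rights) on-left on-right

  right-first : Σ (ST graph) λ T → height graph T ≤ 2 + length (tabulate (right ∘ suc)) ×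
    (∀ {u v} → u L.∈ rights → v L.∈ lefts → Above graph T u v)
  right-first = chain false _ _ _ _
    (all-lists rights-unique lefts-unique on-right on-left (Sum.swap ∘ ∈-lefts⊎rights)) on-right on-left

  tree-depth : TreeDepthAtMost graph (2 + p)
  tree-depth with left-first
  -- The list is the tail of `lefts`, of length `p`.
  ... | T , h≤ , _ = T , ≤-trans h≤ (≤-reflexive (cong (2 +_) (length-tabulate (left ∘ suc))))

  diameter-lower-bound : DiamAtLeast graph (suc p * suc q)
  diameter-lower-bound = proj₁ left-first , proj₁ right-first , λ k →
    biclique-bound graph left right left-injective right-injective
      (λ i j → across true {left i} {right j} (side-left i) (side-right j))
      (λ i j → proj₂ (proj₂ left-first) (left∈ i) (right∈ j) ,
               proj₂ (proj₂ right-first) (right∈ j) (left∈ i))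

biclique-graph : ∀ {t n} p q → suc p + suc q ≡ n → 2 + p ≤ t →
  Σ (Graph n) λ G → (Connected G × TreeDepthAtMost G t) × DiamAtLeast G (suc p * suc q)
biclique-graph p q refl 2+p≤t =
  graph side , (graph-connected , proj₁ tree-depth , ≤-trans (proj₂ tree-depth) 2+p≤t) , diameter-lower-bound
  where
  open CompleteBipartite p q
  open Bipartite using (graph)

-- suc p is the minimum of t - 1 and ⌊n/2⌋, so that t ≤ 3 (suc p) and n ≤ 2 (suc q).
balanced-split : ∀ {t n} → 2 ≤ t → t ≤ n →
  ∃ λ p → ∃ λ q → suc p + suc q ≡ n × 2 + p ≤ t × t * n ≤ 6 * (suc p * suc q)
balanced-split {suc (suc t)} {suc (suc n)} (s≤s (s≤s _)) (s≤s (s≤s t≤n)) =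
  p , q , 2+p+q≡2+n , s≤s (s≤s (m⊓n≤m t h)) , bound
  where
  open ≤-Reasoning
  h p q : ℕ
  h = ⌊ n /2⌋
  -- Here `t` and `n` are the given numbers less two, so `suc p` is the announced minimum.
  p = t ⊓ h
  q = n ∸ p

  h+h≤n : h + h ≤ n
  h+h≤n = ≤-trans (+-monoʳ-≤ h (⌊n/2⌋≤⌈n/2⌉ n)) (≤-reflexive (⌊n/2⌋+⌈n/2⌉≡n n))

  p+q≡n : p + q ≡ n
  p+q≡n = m+[n∸m]≡n (≤-trans (m⊓n≤n t h) (⌊n/2⌋≤n n))

  2+p+q≡2+n : suc p + suc q ≡ 2 + n
  2+p+q≡2+n = cong suc (trans (+-suc p q) (cong suc p+q≡n))

  p≤q : p ≤ q
  p≤q = m+n≤o⇒m≤o∸n p (≤-trans (+-mono-≤ (m⊓n≤n t h) (m⊓n≤n t h)) h+h≤n)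

  n≤1+h+h : n ≤ suc (h + h)
  n≤1+h+h = begin
    n                ≡⟨ ⌊n/2⌋+⌈n/2⌉≡n n ⟨
    h + ⌈ n /2⌉      ≤⟨ +-monoʳ-≤ h (⌊n/2⌋-mono (n≤1+n (suc n))) ⟩
    h + suc h        ≡⟨ +-suc h h ⟩
    suc (h + h)      ∎

  t≤1+p+p : t ≤ suc (p + p)
  t≤1+p+p with ⊓-sel t h
  ... | inj₁ p≡t rewrite p≡t = ≤-trans (m≤m+n t t) (n≤1+n _)
  ... | inj₂ p≡h rewrite p≡h = ≤-trans t≤n n≤1+h+h

  2+t≤3*suc-p : 2 + t ≤ 3 * suc p
  2+t≤3*suc-p = begin
    2 + t                   ≤⟨ s≤s (s≤s t≤1+p+p) ⟩
    3 + (p + p)             ≤⟨ +-monoʳ-≤ 3 (m≤n+m (p + p) p) ⟩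
    3 + (p + (p + p))       ≡⟨ cong (λ m → 3 + (p + (p + m))) (+-identityʳ p) ⟨
    3 + 3 * p               ≡⟨ *-suc 3 p ⟨
    3 * suc p               ∎

  2+n≤2*suc-q : 2 + n ≤ 2 * suc q
  2+n≤2*suc-q = begin
    2 + n                   ≡⟨ 2+p+q≡2+n ⟨
    suc p + suc q           ≤⟨ +-monoˡ-≤ (suc q) (s≤s p≤q) ⟩
    suc q + suc q           ≡⟨ cong (suc q +_) (+-identityʳ (suc q)) ⟨
    2 * suc q               ∎

  bound : (2 + t) * (2 + n) ≤ 6 * (suc p * suc q)
  bound = begin
    (2 + t) * (2 + n)           ≤⟨ *-mono-≤ 2+t≤3*suc-p 2+n≤2*suc-q ⟩
    (3 * suc p) * (2 * suc q)   ≡⟨ [m*n]*[o*p]≡[m*o]*[n*p] 3 (suc p) 2 (suc q) ⟩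
    6 * (suc p * suc q)         ∎

theorem4 : (td : ℕ → ℕ) →
    (Σ ℕ λ N₀ → ∀ n → N₀ ≤ n → 2 ≤ td n × td n ≤ n) →
    Σ ℕ λ a → Σ ℕ λ b → Σ ℕ λ N →
    ∀ n → N ≤ n →
    ((G : Graph n) → InFamily td n G → DiamAtMost G (b * td n * n)) ×
    (Σ (Graph n) λ G → InFamily td n G ×
    Σ ℕ λ d → DiamAtLeast G d × td n * n ≤ a * d)
-- The 6 is the loss `3 * 2` in `balanced-split`; the 2 comes from joining two trees through a third
-- of height at most `td n`.
theorem4 td (N₀ , bounds) = 6 , 2 , N₀ , λ n N₀≤n →
  (λ G (conn , depth) → diameter-upper-bound G conn depth) ,
  let (2≤t , t≤n) = bounds n N₀≤n
      (p , q , p+q≡n , 2+p≤t , tn≤) = balanced-split 2≤t t≤n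
      (G , family , diam) = biclique-graph p q p+q≡n 2+p≤t
  in G , family , suc p * suc q , diam , tn≤
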